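{- Let $\sigma$ be a finite vocabulary without constant or function symbols. For every sentence $\varphi$ of index logic $\mathrm{IL(IFP)}$ of vocabulary $\sigma$ there exists an equivalent sentence $\varphi'$ of $\mathrm{IL(IFP)}$ of vocabulary $\sigma$ (i.e. $\mathbf{A}\models\varphi$ iff $\mathbf{A}\models\varphi'$ for all finite ordered $\sigma$-structures $\mathbf{A}$) that does not use the order predicate on terms of sort $\mathbf{v}$, i.e. contains no atomic formula $t_1\le t_2$ with $t_1,t_2$ terms of sort $\mathbf{v}$.
   Context: **Structures.** Here $\sigma$ consists of finitely many relation symbols. A finite ordered $\sigma$-structure $\mathbf{A}$ is a finite structure of vocabulary $\sigma\cup\{\le\}$, $\le\,\notin\sigma$, with $\le^{\mathbf{A}}$ a linear order on $A$. One assumes the domain is $A=\{0,\dots,n-1\}$ with its natural order. $\log$ is the binary logarithm. **Index logic $\mathrm{IL(IFP)}$.** For $\mathbf{A}$ with $|A|=n$ let $\mathit{Num}(\mathbf{A})=\{0,\dots,\lceil\log n\rceil-1\}$. The logic is two-sorted: variables $x,y,\dots$ of sort $\mathbf{v}$ range over $A$; variables $\mathtt{x},\mathtt{y},\dots$ of sort $\mathbf{n}$ range over $\mathit{Num}(\mathbf{A})$; relation variables $X,Y,\dots$ of arity $r$ range over subsets of $\mathit{Num}(\mathbf{A})^r$. The only terms of sort $\mathbf{n}$ are the variables of sort $\mathbf{n}$; since $\sigma$ has no constant or function symbols, the only terms of sort $\mathbf{v}$ are the variables of sort $\mathbf{v}$. Formulas: $$\varphi::= t_1\le t_2\mid \mathtt{x}_1\le\mathtt{x}_2\mid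 R(t_1,\dots,t_k)\mid X(\mathtt{x}_1,\dots,\mathtt{x}_k)\mid(\varphi\wedge\varphi)\mid\neg\varphi\mid[\mathrm{IFP}_{\bar{\mathtt{x}},X}\varphi]\bar{\mathtt{y}}\mid t=\mathit{index}\{\mathtt{x}:\varphi(\mathtt{x})\}\mid\exists x(x=\mathit{index}\{\mathtt{x}:\alpha(\mathtt{x})\}\wedge\varphi)\mid\exists\mathtt{x}\,\varphi,$$ where $t,t_i$ are terms of sort $\mathbf{v}$, $R\in\sigma$, $\bar{\mathtt{x}},\bar{\mathtt{y}}$ are tuples of sort-$\mathbf{n}$ variables of length the arity of $X$, and $x$ does not occur free in $\alpha(\mathtt{x})$. A valuation $\mathit{val}$ assigns to variables values in their ranges; $\mathit{val}(B/\chi)$ changes the value of $\chi$ to $B$. Semantics: atomic formulas $t_1\leq t_2$, $\mathtt{x}_1\le\mathtt{x}_2$, $R(\ldots)$, $X(\ldots)$, Boolean connectives and $\exists\mathtt{x}\,\varphi$ (quantification over $\mathit{Num}(\mathbf{A})$) are as usual; - $\mathbf{A},\mathit{val}\models t=\mathit{index}\{\mathtt{x}:\varphi(\mathtt{x})\}$ iff $\mathit{val}(t)$ in binary is $b_mb_{m-1}\cdots b_0$, where $m=\lceil\log|A|\rceil-1$ and $b_j=1$ iff $\mathbf{A},\mathit{val}(j/\mathtt{x})\models\varphi(\mathtt{x})$; - $\mathbf{A},\mathit{val}\models\exists x(x=\mathit{index}\{\mathtt{x}:\alpha(\mathtt{x})\}\wedge\varphi)$ iff there is $i\in A$ with $\mathbf{A},\mathit{val}(i/x)\models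 x=\mathit{index}\{\mathtt{x}:\alpha(\mathtt{x})\}$ and $\mathbf{A},\mathit{val}(i/x)\models\varphi$; - $\mathbf{A},\mathit{val}\models[\mathrm{IFP}_{\bar{\mathtt{x}},X}\varphi]\bar{\mathtt{y}}$ iff $\mathit{val}(\bar{\mathtt{y}})\in\mathrm{ifp}(F)$, where for $X$ of arity $k$ and $S\subseteq\mathit{Num}(\mathbf{A})^k$, $F(S)=\{\bar a\in\mathit{Num}(\mathbf{A})^k\mid\mathbf{A},\mathit{val}(S/X,\bar a/\bar{\mathtt{x}})\models\varphi\}$, and $\mathrm{ifp}(F)=\bigcup_i S^i$ with $S^0=\emptyset$, $S^{i+1}=S^i\cup F(S^i)$. A sentence is a formula without free variables (of any kind). -}

module Defs where

open import Data.Bool using (Bool; T)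
open import Data.Digit using (Bit; 1b; fromDigits)
open import Data.Empty using (⊥)
open import Data.Fin using (Fin; toℕ; _≤_)
open import Data.List using (List; []; _∷_)
open import Data.List.Membership.Propositional using (_∈_)
open import Data.List.Relation.Unary.All as All using (All; []; _∷_)
open import Data.Nat using (ℕ; zero; suc; _+_; NonZero)
open import Data.Nat.Logarithm using (⌈log₂_⌉)
open import Data.Product using (_×_; ∃-syntax)
open import Data.Unit using (⊤)
open import Data.Vec as Vec using (Vec; []; _∷_; _++_; lookup; toList)
open import Function.Bundles using (_⇔_)
open import Level using (0ℓ)
open import Relation.Binary.PropositionalEquality using (_≡_)
open import Relation.Nullary using (¬_)
open import Relation.Unary using (Pred; ∅; _∪_; ⋃)

record Vocabulary : Set where
  field
    symbols : ℕ
    arity   : Fin symbols → ℕ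

open Vocabulary public

-- The domain is {0, …, size - 1} with its natural order, so the order is not
-- a separate component.

record Structure (σ : Vocabulary) : Set where
  field
    size         : ℕ
    {{nonEmpty}} : NonZero size
    relation     : (R : Fin (symbols σ)) → Vec (Fin size) (arity σ R) → Bool

  Dom : Set
  Dom = Fin size

  Num : Set
  Num = Fin ⌈log₂ size ⌉

open Structure public

-- Formulas are well scoped, with de Bruijn indices for each kind of variable:
-- Formula σ v n Γ has its free variables among v variables of sort 𝐯,
-- n variables of sort 𝐧, and relation variables whose arities are listed in Γ.
-- The most recently bound variable has index zero.

infix  30 _≤ᵛ_ _≤ⁿ_ _≐index_
infix  28 ¬ᶠ_
infixr 25 _∧ᶠ_
infix  20 ∃index_∧_ ∃ⁿ_

data Formula (σ : Vocabulary) (v n : ℕ) (Γ : List ℕ) : Set where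
  _≤ᵛ_ : (t₁ t₂ : Fin v) → Formula σ v n Γ
  _≤ⁿ_ : (x₁ x₂ : Fin n) → Formula σ v n Γ
  rel  : (R : Fin (symbols σ)) → Vec (Fin v) (arity σ R) → Formula σ v n Γ
  var  : ∀ {k} → k ∈ Γ → Vec (Fin n) k → Formula σ v n Γ
  _∧ᶠ_ : (φ ψ : Formula σ v n Γ) → Formula σ v n Γ
  ¬ᶠ_  : (φ : Formula σ v n Γ) → Formula σ v n Γ

  -- [IFP_{x̄,X} φ] ȳ: binds the relation variable X and the tuple x̄ in φ.
  [IFP_]_ : ∀ {k} → Formula σ v (k + n) (k ∷ Γ) → Vec (Fin n) k →
            Formula σ v n Γ

  -- t = index{x : φ}
  _≐index_ : (t : Fin v) (φ : Formula σ v (suc n) Γ) → Formula σ v n Γ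

  -- ∃x (x = index{x : α} ∧ φ): the variable x of sort 𝐯 is in scope in φ only,
  -- so that it cannot occur free in α.
  ∃index_∧_ : (α : Formula σ v (suc n) Γ) (φ : Formula σ (suc v) n Γ) →
              Formula σ v n Γ

  ∃ⁿ_ : (φ : Formula σ v (suc n) Γ) → Formula σ v n Γ

Sentence : Vocabulary → Set
Sentence σ = Formula σ 0 0 []

module _ {A : Set} where

  stage : (Pred A 0ℓ → Pred A 0ℓ) → ℕ → Pred A 0ℓ
  stage F zero    = ∅
  stage F (suc i) = stage F i ∪ F (stage F i)

  ifp : (Pred A 0ℓ → Pred A 0ℓ) → Pred A 0ℓ
  ifp F = ⋃ ℕ (stage F)

-- The ℓ-digit binary representation of i has digit 1 exactly at the positions
-- in P.  As in fromDigits, the least significant digit b₀ comes first in b.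

IsIndex : ∀ {ℓ} → ℕ → Pred (Fin ℓ) 0ℓ → Set
IsIndex {ℓ} i P =
  ∃[ b ] fromDigits (toList b) ≡ i × (∀ (j : Fin ℓ) → lookup b j ≡ 1b ⇔ P j)

record Valuation {σ : Vocabulary} (A : Structure σ) (v n : ℕ) (Γ : List ℕ) :
                 Set₁ where
  constructor ⟨_,_,_⟩
  field
    elems : Vec (Dom A) v
    nums  : Vec (Num A) n
    rels  : All (λ k → Pred (Vec (Num A) k) 0ℓ) Γ

infix 4 _,_⊨_ _⊨_

_,_⊨_ : ∀ {σ v n Γ} (A : Structure σ) → Valuation A v n Γ →
        Formula σ v n Γ → Set
A , ⟨ e , m , r ⟩ ⊨ t₁ ≤ᵛ t₂ = lookup e t₁ ≤ lookup e t₂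
A , ⟨ e , m , r ⟩ ⊨ x₁ ≤ⁿ x₂ = lookup m x₁ ≤ lookup m x₂
A , ⟨ e , m , r ⟩ ⊨ rel R ts = T (relation A R (Vec.map (lookup e) ts))
A , ⟨ e , m , r ⟩ ⊨ var X xs = All.lookup r X (Vec.map (lookup m) xs)
A , val ⊨ φ ∧ᶠ ψ = A , val ⊨ φ × A , val ⊨ ψ
A , val ⊨ ¬ᶠ φ = ¬ (A , val ⊨ φ)
A , ⟨ e , m , r ⟩ ⊨ [IFP φ ] ys =
  ifp (λ S as → A , ⟨ e , as ++ m , S ∷ r ⟩ ⊨ φ) (Vec.map (lookup m) ys)
A , ⟨ e , m , r ⟩ ⊨ t ≐index φ =
  IsIndex (toℕ (lookup e t)) (λ j → A , ⟨ e , j ∷ m , r ⟩ ⊨ φ)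
A , ⟨ e , m , r ⟩ ⊨ ∃index α ∧ φ =
  ∃[ i ] IsIndex (toℕ i) (λ j → A , ⟨ e , j ∷ m , r ⟩ ⊨ α)
       × A , ⟨ i ∷ e , m , r ⟩ ⊨ φ
A , ⟨ e , m , r ⟩ ⊨ ∃ⁿ φ = ∃[ j ] A , ⟨ e , j ∷ m , r ⟩ ⊨ φ

_⊨_ : ∀ {σ} → Structure σ → Sentence σ → Set
A ⊨ φ = A , ⟨ [] , [] , [] ⟩ ⊨ φ

-- The formula contains no atomic subformula t₁ ≤ t₂ of sort 𝐯.

OrderFree : ∀ {σ v n Γ} → Formula σ v n Γ → Set
OrderFree (t₁ ≤ᵛ t₂)     = ⊥
OrderFree (x₁ ≤ⁿ x₂)     = ⊤
OrderFree (rel R ts)     = ⊤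
OrderFree (var X xs)     = ⊤
OrderFree (φ ∧ᶠ ψ)       = OrderFree φ × OrderFree ψ
OrderFree (¬ᶠ φ)         = OrderFree φ
OrderFree ([IFP φ ] ys)  = OrderFree φ
OrderFree (t ≐index φ)   = OrderFree φ
OrderFree (∃index α ∧ φ) = OrderFree α × OrderFree φ
OrderFree (∃ⁿ φ)         = OrderFree φ

{-# OPTIONS --safe #-}

-- In a sentence, every variable t of sort 𝐯 is bound by some
-- ∃t (t = index{x : α} ∧ …), so inside its scope the binary digits of t are
-- defined by α.  After removing the order from α, an atom t₁ ≤ t₂ becomes the
-- lexicographic comparison of the digits of t₁ and t₂, which only needs
-- quantification over, and the order of, positions.
--
-- The argument is constructive without deciding satisfaction: the comparison
-- only concerns the digits of t₁ and t₂, and these are decided by the digit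
-- vectors that IsIndex provides.

module Submission where

open import Defs
open import Data.Bool using (T)
open import Data.Digit using (Bit; 1b; fromDigits)
open import Data.Fin using (Fin; zero; suc; toℕ; lift; _↑ʳ_; _≤_)
import Data.Fin.Properties as Fin
open import Data.List using (List)
open import Data.List.Membership.Propositional using (_∈_)
open import Data.List.Relation.Binary.Subset.Propositional using (_⊆_)
open import Data.List.Relation.Binary.Subset.Propositional.Properties
  using (∷⁺ʳ)
open import Data.List.Relation.Unary.All as All using (All; _∷_)
open import Data.List.Relation.Unary.Any using (here; there)
open import Data.Nat as ℕ using (ℕ; suc; _+_; _*_; z≤n; s≤s)
import Data.Nat.Properties as ℕ
open import Data.Product using (_×_; _,_; ∃; ∃-syntax)
open import Data.Product.Function.Dependent.Propositional using (Σ-⇔)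
open import Data.Product.Function.NonDependent.Propositional using (_×-⇔_)
open import Data.Sum using (_⊎_; inj₁; inj₂)
open import Data.Sum.Function.Propositional using (_⊎-⇔_)
open import Data.Unit using (tt)
open import Data.Vec as Vec using (Vec; []; _∷_; _++_; lookup; toList)
open import Data.Vec.Functional as Vector using (Vector)
import Data.Vec.Properties as Vec
open import Function using (_∘_; id)
open import Function.Bundles using (_⇔_; mk⇔; Equivalence)
open import Function.Construct.Composition using (_⇔-∘_)
open import Function.Construct.Identity using (⇔-id; ↠-id)
open import Function.Construct.Symmetry using (⇔-sym)
open import Function.Related.TypeIsomorphisms using (¬-cong-⇔)
open import Level using (0ℓ)
open import Relation.Binary.PropositionalEquality
  using (_≡_; refl; sym; trans; cong; cong₂)
open import Relation.Nullary using (¬_; contradiction)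
open import Relation.Nullary.Decidable using (decidable-stable)
open import Relation.Unary using (Pred)

open Equivalence using (to; from)

private variable
  σ : Vocabulary
  v v′ n n′ k ℓ : ℕ
  Γ Γ′ : List ℕ

-- Congruence of quantifiers, fixed points and indices

∃-cong-⇔ : {A : Set} {P Q : Pred A 0ℓ} → (∀ a → P a ⇔ Q a) → ∃ P ⇔ ∃ Q
∃-cong-⇔ P⇔Q = Σ-⇔ (↠-id _) (P⇔Q _)

≡⇒⇔ : {A B : Set} → A ≡ B → A ⇔ B
≡⇒⇔ refl = ⇔-id _

infix 4 _⇔₁_

_⇔₁_ : {A : Set} → Pred A 0ℓ → Pred A 0ℓ → Set
P ⇔₁ Q = ∀ a → P a ⇔ Q a

module _ {A : Set} {F G : Pred A 0ℓ → Pred A 0ℓ}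
         (F⇔G : ∀ {S T} → S ⇔₁ T → F S ⇔₁ G T) where

  -- Corresponding stages are only pointwise equivalent, not equal as predicates, so the hypothesis
  -- has to compare `F` and `G` at equivalent arguments.
  stage-cong : ∀ i → stage F i ⇔₁ stage G i
  stage-cong ℕ.zero  a = ⇔-id _
  stage-cong (suc i) a = stage-cong i a ⊎-⇔ F⇔G (stage-cong i) a

  ifp-cong : ifp F ⇔₁ ifp G
  ifp-cong a = ∃-cong-⇔ λ i → stage-cong i a

IsIndex-cong : ∀ {i j} {P Q : Pred (Fin ℓ) 0ℓ} → i ≡ j → P ⇔₁ Q →
               IsIndex i P ⇔ IsIndex j Q
IsIndex-cong refl P⇔Q = mk⇔
  (λ (b , b≡i , b⇔P) → b , b≡i , λ j → P⇔Q j ⇔-∘ b⇔P j)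
  (λ (b , b≡i , b⇔Q) → b , b≡i , λ j → ⇔-sym (P⇔Q j) ⇔-∘ b⇔Q j)

-- Lexicographic comparison of digits

-- Above j it suffices that P ⊆ Q: any difference there also puts P below Q.

Below : Pred (Fin ℓ) 0ℓ → Pred (Fin ℓ) 0ℓ → Set
Below P Q = ∃[ j ] (Q j × ¬ P j) × ¬ (∃[ i ] (P i × ¬ Q i) × ¬ i ≤ j)

Below-cong : {P P′ Q Q′ : Pred (Fin ℓ) 0ℓ} → P ⇔₁ P′ → Q ⇔₁ Q′ →
             Below P Q ⇔ Below P′ Q′
Below-cong P⇔ Q⇔ = ∃-cong-⇔ λ j →
  (Q⇔ j ×-⇔ ¬-cong-⇔ (P⇔ j)) ×-⇔
  ¬-cong-⇔ (∃-cong-⇔ λ i → (P⇔ i ×-⇔ ¬-cong-⇔ (Q⇔ i)) ×-⇔ ⇔-id _)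

Ones : Vec Bit ℓ → Pred (Fin ℓ) 0ℓ
Ones b j = lookup b j ≡ 1b

value : Vec Bit ℓ → ℕ
value b = fromDigits (toList b)

value-mono : (b c : Vec Bit ℓ) → (∀ j → Ones b j → Ones c j) →
             value b ℕ.≤ value c
value-mono []       []       _   = z≤n
value-mono (x ∷ b) (y ∷ c) b⊆c =
  ℕ.+-mono-≤ (digit x y (b⊆c zero))
             (ℕ.*-monoˡ-≤ 2 (value-mono b c (b⊆c ∘ suc)))
  where
  digit : (x y : Bit) → (x ≡ 1b → y ≡ 1b) → toℕ x ℕ.≤ toℕ y
  digit zero       y x⇒y = z≤n
  digit (suc zero) y x⇒y = ℕ.≤-reflexive (cong toℕ (sym (x⇒y refl)))

-- A lowest digit is less than 2, so it cannot make up for a difference in the higher digits.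
digit+2*-mono-< : (x y : Bit) {p q : ℕ} → p ℕ.< q →
                  toℕ x + p * 2 ℕ.< toℕ y + q * 2
digit+2*-mono-< x y {p} {q} p<q = begin-strict
  toℕ x + p * 2  <⟨ ℕ.+-monoˡ-< (p * 2) (Fin.toℕ<n x) ⟩
  suc p * 2      ≤⟨ ℕ.*-monoˡ-≤ 2 p<q ⟩
  q * 2          ≤⟨ ℕ.m≤n+m (q * 2) (toℕ y) ⟩
  toℕ y + q * 2  ∎
  where open ℕ.≤-Reasoning

-- If the witness is the head, the least significant digit, then the heads are 0 and 1 and the tails
-- are ordered by inclusion. Otherwise the tails already differ strictly.
Below⇒value< : (b c : Vec Bit ℓ) → Below (Ones b) (Ones c) →
               value b ℕ.< value c
Below⇒value< (suc zero ∷ b) (y ∷ c) (zero , (_ , x≢1) , _) =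
  contradiction refl x≢1
Below⇒value< (zero ∷ b) (y ∷ c) (zero , (refl , _) , b⊆c) =
  -- `Below` yields the inclusion only up to double negation, which decidable equality of bits
  -- removes.
  s≤s (ℕ.*-monoˡ-≤ 2 (value-mono b c λ i bi →
    decidable-stable (lookup c i Fin.≟ 1b)
      λ ¬ci → b⊆c (suc i , (bi , ¬ci) , λ ())))
Below⇒value< (x ∷ b) (y ∷ c) (suc j , j∈ , b⊆c) =
  digit+2*-mono-< x y (Below⇒value< b c
    (j , j∈ , λ (i , i∈ , i≰j) → b⊆c (suc i , i∈ , i≰j ∘ ℕ.s≤s⁻¹)))

Below-∷ : (x y : Bit) (b c : Vec Bit ℓ) → Below (Ones b) (Ones c) →
          Below (Ones (x ∷ b)) (Ones (y ∷ c))
Below-∷ x y b c (j , j∈ , b⊆c) = suc j , j∈ , λ where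
  (zero  , _  , 0≰j) → 0≰j z≤n
  (suc i , i∈ , i≰j) → b⊆c (i , i∈ , i≰j ∘ s≤s)

Below-head : (b : Vec Bit ℓ) → Below (Ones (zero ∷ b)) (Ones (1b ∷ b))
Below-head b = zero , (refl , λ ()) , λ where
  (zero  , _ , 0≰0)        → 0≰0 z≤n
  (suc i , (bi , ¬bi) , _) → ¬bi bi

-- The tails carry the more significant digits, so the heads are consulted only when the tails are
-- equal.
Below-connected : (b c : Vec Bit ℓ) →
  Below (Ones b) (Ones c) ⊎ b ≡ c ⊎ Below (Ones c) (Ones b)
Below-connected []      []      = inj₂ (inj₁ refl)
Below-connected (x ∷ b) (y ∷ c) with Below-connected b c
... | inj₁ b<c        = inj₁ (Below-∷ x y b c b<c)
... | inj₂ (inj₂ c<b) = inj₂ (inj₂ (Below-∷ y x c b c<b))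
... | inj₂ (inj₁ refl) with x | y
...   | zero     | zero     = inj₂ (inj₁ refl)
...   | zero     | suc zero = inj₁ (Below-head b)
...   | suc zero | zero     = inj₂ (inj₂ (Below-head b))
...   | suc zero | suc zero = inj₂ (inj₁ refl)

-- Negating the converse strict comparison covers equality as well, so no separate clause for equal
-- digits is needed.
value≤⇔¬Below : (b c : Vec Bit ℓ) →
                value b ℕ.≤ value c ⇔ (¬ Below (Ones c) (Ones b))
value≤⇔¬Below b c = mk⇔ (λ b≤c c<b → ℕ.<⇒≱ (Below⇒value< c b c<b) b≤c) ≮⇒≤
  where
  ≮⇒≤ : ¬ Below (Ones c) (Ones b) → value b ℕ.≤ value c
  ≮⇒≤ c≮b with Below-connected b c
  ... | inj₁ b<c         = ℕ.<⇒≤ (Below⇒value< b c b<c)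
  ... | inj₂ (inj₁ refl) = ℕ.≤-refl
  ... | inj₂ (inj₂ c<b)  = contradiction c<b c≮b

≤⇔¬Below : ∀ {i j} {P Q : Pred (Fin ℓ) 0ℓ} → IsIndex i P → IsIndex j Q →
           i ℕ.≤ j ⇔ (¬ Below Q P)
≤⇔¬Below (b , refl , b⇔P) (c , refl , c⇔Q) =
  ¬-cong-⇔ (Below-cong c⇔Q b⇔P) ⇔-∘ value≤⇔¬Below b c

-- Renaming

-- The formula defining the digits of a variable is copied to places under further binders of all
-- three kinds, and so has to be moved into larger scopes.
rename : (Fin v → Fin v′) → (Fin n → Fin n′) → Γ ⊆ Γ′ →
         Formula σ v n Γ → Formula σ v′ n′ Γ′
rename f g h (t₁ ≤ᵛ t₂)     = f t₁ ≤ᵛ f t₂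
rename f g h (x₁ ≤ⁿ x₂)     = g x₁ ≤ⁿ g x₂
rename f g h (rel R ts)     = rel R (Vec.map f ts)
rename f g h (var X xs)     = var (h X) (Vec.map g xs)
rename f g h (φ ∧ᶠ ψ)       = rename f g h φ ∧ᶠ rename f g h ψ
rename f g h (¬ᶠ φ)         = ¬ᶠ rename f g h φ
rename f g h ([IFP_]_ {k} φ ys) =
  [IFP rename f (lift k g) (∷⁺ʳ k h) φ ] Vec.map g ys
rename f g h (t ≐index φ)   = f t ≐index rename f (lift 1 g) h φ
rename f g h (∃index α ∧ φ) =
  ∃index rename f (lift 1 g) h α ∧ rename (lift 1 f) g h φ
rename f g h (∃ⁿ φ)         = ∃ⁿ rename f (lift 1 g) h φ

rename-orderFree : (f : Fin v → Fin v′) (g : Fin n → Fin n′) (h : Γ ⊆ Γ′)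
  (φ : Formula σ v n Γ) → OrderFree φ → OrderFree (rename f g h φ)
rename-orderFree f g h (x₁ ≤ⁿ x₂)     _       = tt
rename-orderFree f g h (rel R ts)     _       = tt
rename-orderFree f g h (var X xs)     _       = tt
rename-orderFree f g h (φ ∧ᶠ ψ)       (p , q) =
  rename-orderFree f g h φ p , rename-orderFree f g h ψ q
rename-orderFree f g h (¬ᶠ φ)         p       = rename-orderFree f g h φ p
rename-orderFree f g h ([IFP φ ] ys)  p       = rename-orderFree f _ _ φ p
rename-orderFree f g h (t ≐index φ)   p       = rename-orderFree f _ h φ p
rename-orderFree f g h (∃index α ∧ φ) (p , q) =
  rename-orderFree f _ h α p , rename-orderFree _ g h φ q
rename-orderFree f g h (∃ⁿ φ)         p       = rename-orderFree f _ h φ p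

module _ {X : Set} where

  Agree : (Fin n → Fin n′) → Vec X n → Vec X n′ → Set
  Agree f xs ys = ∀ i → lookup ys (f i) ≡ lookup xs i

  Agree-lift : {f : Fin n → Fin n′} {xs : Vec X n} {ys : Vec X n′}
    (zs : Vec X k) → Agree f xs ys → Agree (lift k f) (zs ++ xs) (zs ++ ys)
  Agree-lift []       eq i       = eq i
  Agree-lift (z ∷ zs) eq zero    = refl
  Agree-lift (z ∷ zs) eq (suc i) = Agree-lift zs eq i

  Agree-map : {f : Fin n → Fin n′} (xs : Vec X n) (ys : Vec X n′) →
    Agree f xs ys → (is : Vec (Fin n) k) →
    Vec.map (lookup ys) (Vec.map f is) ≡ Vec.map (lookup xs) is
  Agree-map {f = f} xs ys eq is =
    trans (sym (Vec.map-∘ (lookup ys) f is)) (Vec.map-cong eq is)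

module _ {X : Set} where

  private
    Relations : List ℕ → Set₁
    Relations = All (λ k → Pred (Vec X k) 0ℓ)

  -- Equivalence instead of equality, because under a fixed point the relation variable is
  -- interpreted by stages that are merely equivalent.
  RelAgree : Γ ⊆ Γ′ → Relations Γ → Relations Γ′ → Set
  RelAgree {Γ} h r r′ =
    ∀ {k} (R : k ∈ Γ) → All.lookup r R ⇔₁ All.lookup r′ (h R)

  RelAgree-∷ : {h : Γ ⊆ Γ′} {r : Relations Γ} {r′ : Relations Γ′}
    {S T : Pred (Vec X k) 0ℓ} → S ⇔₁ T → RelAgree h r r′ →
    RelAgree (∷⁺ʳ k h) (S ∷ r) (T ∷ r′)
  RelAgree-∷ S⇔T r⇔r′ (here refl) = S⇔T
  RelAgree-∷ S⇔T r⇔r′ (there R)   = r⇔r′ R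

module _ (A : Structure σ) where

  -- The usual renaming lemma, for arbitrary agreeing valuations so that the induction passes
  -- binders. In the clauses, `f`, `g` and `h` are the proofs of agreement.
  rename-⊨ : {f : Fin v → Fin v′} {g : Fin n → Fin n′} {h : Γ ⊆ Γ′}
    {e : Vec (Dom A) v} {e′ : Vec (Dom A) v′}
    {m : Vec (Num A) n} {m′ : Vec (Num A) n′}
    {r : All (λ k → Pred (Vec (Num A) k) 0ℓ) Γ}
    {r′ : All (λ k → Pred (Vec (Num A) k) 0ℓ) Γ′} →
    Agree f e e′ → Agree g m m′ → RelAgree h r r′ → (φ : Formula σ v n Γ) →
    (A , ⟨ e , m , r ⟩ ⊨ φ) ⇔ (A , ⟨ e′ , m′ , r′ ⟩ ⊨ rename f g h φ)
  rename-⊨ f g h (t₁ ≤ᵛ t₂) = ≡⇒⇔ (sym (cong₂ _≤_ (f t₁) (f t₂)))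
  rename-⊨ f g h (x₁ ≤ⁿ x₂) = ≡⇒⇔ (sym (cong₂ _≤_ (g x₁) (g x₂)))
  rename-⊨ {e = e} {e′} f g h (rel R ts) =
    ≡⇒⇔ (cong (T ∘ relation A R) (sym (Agree-map e e′ f ts)))
  rename-⊨ {h = ρ} {m = m} {m′} {r′ = r′} f g h (var X xs) =
    ≡⇒⇔ (cong (All.lookup r′ (ρ X)) (sym (Agree-map m m′ g xs))) ⇔-∘ h X _
  rename-⊨ f g h (φ ∧ᶠ ψ) = rename-⊨ f g h φ ×-⇔ rename-⊨ f g h ψ
  rename-⊨ f g h (¬ᶠ φ) = ¬-cong-⇔ (rename-⊨ f g h φ)
  rename-⊨ {m = m} {m′} f g h ([IFP φ ] ys) =
    ≡⇒⇔ (cong (ifp _) (sym (Agree-map m m′ g ys))) ⇔-∘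
    ifp-cong (λ S⇔T as →
      rename-⊨ f (Agree-lift as g) (RelAgree-∷ S⇔T h) φ) _
  rename-⊨ f g h (t ≐index φ) =
    IsIndex-cong (cong toℕ (sym (f t)))
      λ j → rename-⊨ f (Agree-lift (j ∷ []) g) h φ
  rename-⊨ f g h (∃index α ∧ φ) = ∃-cong-⇔ λ i →
    IsIndex-cong refl (λ j → rename-⊨ f (Agree-lift (j ∷ []) g) h α) ×-⇔
    rename-⊨ (Agree-lift (i ∷ []) f) g h φ
  rename-⊨ f g h (∃ⁿ φ) = ∃-cong-⇔ λ j →
    rename-⊨ f (Agree-lift (j ∷ []) g) h φ

-- Elimination of the order

-- The formula δ t, with distinguished variable 0 of sort 𝐧, is meant to
-- define the digits of t.

DigitFormulas : (σ : Vocabulary) (v n : ℕ) (Γ : List ℕ) → Set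
DigitFormulas σ v n Γ = Vector (Formula σ v (suc n) Γ) v

-- `lift 1` keeps the digit position as variable 0, in front of the `k` new variables.
weaken : ∀ k → Γ ⊆ Γ′ → DigitFormulas σ v n Γ → DigitFormulas σ v (k + n) Γ′
weaken k h δ t = rename id (lift 1 (k ↑ʳ_)) h (δ t)

infixr 5 _◂_

-- `α` is renamed along with the others: it comes from outside the scope of the new variable whose
-- digits it defines.
_◂_ : Formula σ v (suc n) Γ → DigitFormulas σ v n Γ →
      DigitFormulas σ (suc v) n Γ
α ◂ δ = rename suc id id ∘ (α Vector.∷ δ)

belowᶠ : (α β : Formula σ v (suc n) Γ) → Formula σ v n Γ
belowᶠ α β =
  ∃ⁿ (β ∧ᶠ ¬ᶠ α) ∧ᶠ
     -- Here variable 0 is the position i of `Below` and variable 1 is j; `shift` makes room for j.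
     ¬ᶠ (∃ⁿ (shift α ∧ᶠ ¬ᶠ shift β) ∧ᶠ ¬ᶠ (zero ≤ⁿ suc zero))
  where
  shift : Formula σ v (suc n) Γ → Formula σ v (suc (suc n)) Γ
  shift = rename id (lift 1 suc) id

removeOrder : DigitFormulas σ v n Γ → Formula σ v n Γ → Formula σ v n Γ
removeOrder δ (t₁ ≤ᵛ t₂)     = ¬ᶠ belowᶠ (δ t₂) (δ t₁)
removeOrder δ (x₁ ≤ⁿ x₂)     = x₁ ≤ⁿ x₂
removeOrder δ (rel R ts)     = rel R ts
removeOrder δ (var X xs)     = var X xs
removeOrder δ (φ ∧ᶠ ψ)       = removeOrder δ φ ∧ᶠ removeOrder δ ψ
removeOrder δ (¬ᶠ φ)         = ¬ᶠ removeOrder δ φ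
-- Digit formulas may mention outer relation variables; `there` skips the one bound here, so nothing
-- is captured.
removeOrder δ ([IFP_]_ {k} φ ys) = [IFP removeOrder (weaken k there δ) φ ] ys
removeOrder δ (t ≐index φ)   = t ≐index removeOrder (weaken 1 id δ) φ
-- The order is removed from `α` first, so that the digit formulas stay order-free.
removeOrder δ (∃index α ∧ φ) = ∃index α′ ∧ removeOrder (α′ ◂ δ) φ
  where α′ = removeOrder (weaken 1 id δ) α
removeOrder δ (∃ⁿ φ)         = ∃ⁿ removeOrder (weaken 1 id δ) φ

AllOrderFree : DigitFormulas σ v n Γ → Set
AllOrderFree δ = ∀ t → OrderFree (δ t)

weaken-orderFree : ∀ k (h : Γ ⊆ Γ′) (δ : DigitFormulas σ v n Γ) →
                   AllOrderFree δ → AllOrderFree (weaken k h δ)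
weaken-orderFree k h δ p t = rename-orderFree id _ h (δ t) (p t)

◂-orderFree : (α : Formula σ v (suc n) Γ) (δ : DigitFormulas σ v n Γ) →
              OrderFree α → AllOrderFree δ → AllOrderFree (α ◂ δ)
◂-orderFree α δ p q zero    = rename-orderFree suc id id α p
◂-orderFree α δ p q (suc t) = rename-orderFree suc id id (δ t) (q t)

removeOrder-orderFree : (δ : DigitFormulas σ v n Γ) → AllOrderFree δ →
  (φ : Formula σ v n Γ) → OrderFree (removeOrder δ φ)
removeOrder-orderFree δ p (t₁ ≤ᵛ t₂) =
  (p t₁ , p t₂) ,
  (rename-orderFree id _ id (δ t₂) (p t₂) ,
   rename-orderFree id _ id (δ t₁) (p t₁)) , tt
removeOrder-orderFree δ p (x₁ ≤ⁿ x₂)   = tt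
removeOrder-orderFree δ p (rel R ts)   = tt
removeOrder-orderFree δ p (var X xs)   = tt
removeOrder-orderFree δ p (φ ∧ᶠ ψ)     =
  removeOrder-orderFree δ p φ , removeOrder-orderFree δ p ψ
removeOrder-orderFree δ p (¬ᶠ φ)       = removeOrder-orderFree δ p φ
removeOrder-orderFree δ p ([IFP φ ] _) =
  removeOrder-orderFree _ (weaken-orderFree _ there δ p) φ
removeOrder-orderFree δ p (t ≐index φ) =
  removeOrder-orderFree _ (weaken-orderFree 1 id δ p) φ
removeOrder-orderFree δ p (∃index α ∧ φ) =
  α′-orderFree , removeOrder-orderFree _ (◂-orderFree _ δ α′-orderFree p) φ
  where α′-orderFree = removeOrder-orderFree _ (weaken-orderFree 1 id δ p) α
removeOrder-orderFree δ p (∃ⁿ φ)       =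
  removeOrder-orderFree _ (weaken-orderFree 1 id δ p) φ

-- Correctness of the elimination

module _ (A : Structure σ) where

  -- The invariant of the translation: it is extended to a new variable at `∃index` and preserved by
  -- every other binder.
  DefinesDigits : Valuation A v n Γ → DigitFormulas σ v n Γ → Set
  DefinesDigits ⟨ e , m , r ⟩ δ =
    ∀ t → IsIndex (toℕ (lookup e t)) λ j → A , ⟨ e , j ∷ m , r ⟩ ⊨ δ t

  private variable
    e : Vec (Dom A) v
    m : Vec (Num A) n
    r r′ : All (λ k → Pred (Vec (Num A) k) 0ℓ) Γ

  weaken-DefinesDigits : {h : Γ ⊆ Γ′} → RelAgree h r r′ →
    (δ : DigitFormulas σ v n Γ) (js : Vec (Num A) k) →
    DefinesDigits ⟨ e , m , r ⟩ δ →
    DefinesDigits ⟨ e , js ++ m , r′ ⟩ (weaken k h δ)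
  weaken-DefinesDigits h δ js def t = to
    (IsIndex-cong refl λ j → rename-⊨ A (λ _ → refl)
      (Agree-lift (j ∷ []) (Vec.lookup-++ʳ js _)) h (δ t))
    (def t)

  ◂-DefinesDigits : ∀ {i} (α : Formula σ v (suc n) Γ)
    (δ : DigitFormulas σ v n Γ) →
    IsIndex (toℕ i) (λ j → A , ⟨ e , j ∷ m , r ⟩ ⊨ α) →
    DefinesDigits ⟨ e , m , r ⟩ δ →
    DefinesDigits ⟨ i ∷ e , m , r ⟩ (α ◂ δ)
  ◂-DefinesDigits α δ idx def zero = to
    (IsIndex-cong refl λ j →
      rename-⊨ A (λ _ → refl) (λ _ → refl) (λ _ _ → ⇔-id _) α)
    idx
  ◂-DefinesDigits α δ idx def (suc t) = to
    (IsIndex-cong refl λ j →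
      rename-⊨ A (λ _ → refl) (λ _ → refl) (λ _ _ → ⇔-id _) (δ t))
    (def t)

  belowᶠ-⊨ : (α β : Formula σ v (suc n) Γ) →
    Below (λ j → A , ⟨ e , j ∷ m , r ⟩ ⊨ α)
          (λ j → A , ⟨ e , j ∷ m , r ⟩ ⊨ β) ⇔
    (A , ⟨ e , m , r ⟩ ⊨ belowᶠ α β)
  belowᶠ-⊨ α β = ∃-cong-⇔ λ j → ⇔-id _ ×-⇔ ¬-cong-⇔ (∃-cong-⇔ λ i →
    (shift i j α ×-⇔ ¬-cong-⇔ (shift i j β)) ×-⇔ ⇔-id _)
    where
    shift : ∀ i j φ → _
    shift i j = rename-⊨ A (λ _ → refl)
      (Agree-lift (i ∷ []) (λ _ → refl)) (λ _ _ → ⇔-id _)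

  -- Two interpretations of the relation variables are needed, as the stages of a fixed point and of
  -- its translation are only equivalent. The digit formulas are already translated, so the
  -- invariant concerns `r′`.
  removeOrder-⊨ : (δ : DigitFormulas σ v n Γ) →
    DefinesDigits ⟨ e , m , r′ ⟩ δ → RelAgree id r r′ →
    (φ : Formula σ v n Γ) →
    (A , ⟨ e , m , r ⟩ ⊨ φ) ⇔ (A , ⟨ e , m , r′ ⟩ ⊨ removeOrder δ φ)
  removeOrder-⊨ δ def h (t₁ ≤ᵛ t₂) =
    ¬-cong-⇔ (belowᶠ-⊨ (δ t₂) (δ t₁)) ⇔-∘ ≤⇔¬Below (def t₁) (def t₂)
  removeOrder-⊨ δ def h (x₁ ≤ⁿ x₂) = ⇔-id _
  removeOrder-⊨ δ def h (rel R ts) = ⇔-id _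
  removeOrder-⊨ δ def h (var X xs) = h X _
  removeOrder-⊨ δ def h (φ ∧ᶠ ψ) =
    removeOrder-⊨ δ def h φ ×-⇔ removeOrder-⊨ δ def h ψ
  removeOrder-⊨ δ def h (¬ᶠ φ) = ¬-cong-⇔ (removeOrder-⊨ δ def h φ)
  removeOrder-⊨ δ def h ([IFP φ ] ys) = ifp-cong (λ S⇔T as →
    removeOrder-⊨ _
      (weaken-DefinesDigits (λ _ _ → ⇔-id _) δ as def)
      (λ where (here refl) → S⇔T
               (there R)   → h R) φ) _
  removeOrder-⊨ δ def h (t ≐index φ) = IsIndex-cong refl λ j →
    removeOrder-⊨ _
      (weaken-DefinesDigits (λ _ _ → ⇔-id _) δ (j ∷ []) def) h φ
  removeOrder-⊨ {e = e} {m} {r′} {r} δ def h (∃index α ∧ φ) =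
    -- The two bodies are equivalent only for the `i` that has the digits given by `α′`, so the
    -- index condition is transferred first and then used for the body.
    ∃-cong-⇔ λ i → mk⇔
      (λ (idx , sat) → let idx′ = to index⇔ idx in
         idx′ , to (body⇔ idx′) sat)
      (λ (idx′ , sat) → from index⇔ idx′ , from (body⇔ idx′) sat)
    where
    α′ = removeOrder (weaken 1 id δ) α

    index⇔ : ∀ {i} → IsIndex i (λ j → A , ⟨ e , j ∷ m , r ⟩ ⊨ α) ⇔
                     IsIndex i (λ j → A , ⟨ e , j ∷ m , r′ ⟩ ⊨ α′)
    index⇔ = IsIndex-cong refl λ j → removeOrder-⊨ _
      (weaken-DefinesDigits (λ _ _ → ⇔-id _) δ (j ∷ []) def) h α

    body⇔ : ∀ {i} → IsIndex (toℕ i) (λ j → A , ⟨ e , j ∷ m , r′ ⟩ ⊨ α′) →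
            (A , ⟨ i ∷ e , m , r ⟩ ⊨ φ) ⇔
            (A , ⟨ i ∷ e , m , r′ ⟩ ⊨ removeOrder (α′ ◂ δ) φ)
    body⇔ idx′ = removeOrder-⊨ _ (◂-DefinesDigits α′ δ idx′ def) h φ
  removeOrder-⊨ δ def h (∃ⁿ φ) = ∃-cong-⇔ λ j → removeOrder-⊨ _
    (weaken-DefinesDigits (λ _ _ → ⇔-id _) δ (j ∷ []) def) h φ

theorem4 : (σ : Vocabulary) (φ : Sentence σ) →
    ∃[ φ′ ] (OrderFree φ′ × ((A : Structure σ) → (A ⊨ φ) ⇔ (A ⊨ φ′)))
theorem4 σ φ =
  -- A sentence has no free variables of sort 𝐯, so the family of digit formulas is empty and its
  -- conditions hold vacuously.
  removeOrder δ φ , removeOrder-orderFree δ (λ ()) φ ,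
  λ A → removeOrder-⊨ A δ (λ ()) (λ _ _ → ⇔-id _) φ
  where
  δ : DigitFormulas σ 0 0 _
  δ ()
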